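{- Assume that $\{A_0,A_1\}$ is a partition of $\mathbb R$ which is a $2$-S-covering. Then at least one of the sets $A_0,A_1$ is a $2$-covering.
   Context: A family $\mathcal A$ of pairwise disjoint subsets of $\mathbb R$ is a $\kappa$-S-covering if $|\mathcal A|=\kappa$ and for every $F\subseteq\mathbb R$ with $|F|=\kappa$ there is $t\in\mathbb R$ such that $F+t\subseteq\bigcup\mathcal A$ and $|(F+t)\cap A|=1$ for every $A\in\mathcal A$. A set $A\subseteq\mathbb R$ is a $2$-covering if for every $B\subseteq\mathbb R$ with $|B|=2$ there is $x\in\mathbb R$ with $B+x\subseteq A$. -}

module Defs where

open import Data.Fin.Base using (Fin)
open import Data.Nat.Base as ℕ using (ℕ)
import Data.Nat.Properties as ℕₚ
open import Data.Product.Base using (∃; ∃-syntax; Σ-syntax; _×_; _,_; proj₁; swap)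
open import Data.Rational.Base as ℚ using (ℚ; 0ℚ; ½; ∣_∣)
import Data.Rational.Properties as ℚₚ
open import Data.Rational.Solver using (module +-*-Solver)
open import Data.Sum.Base as Sum using (_⊎_)
open import Function.Bundles using (Bijection)
open import Level using (Level; _⊔_; suc; 0ℓ)
open import Relation.Binary.Bundles using (Setoid)
open import Relation.Binary.Definitions using (_Respects_)
open import Relation.Binary.PropositionalEquality as ≡
  using (_≡_; refl; cong; subst)
import Relation.Binary.Construct.On as On
open import Relation.Nullary.Negation.Core using (¬_)
open import Relation.Unary as U using (Pred; _∈_; _⊆_; _≐_; _⊥_)

------------------------------------------------------------------------
-- The real numbers: Cauchy sequences of rationals, equal when their
-- difference tends to 0.

IsCauchy : (ℕ → ℚ) → Set
IsCauchy s = ∀ ε → 0ℚ ℚ.< ε →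
  ∃[ N ] (∀ m n → N ℕ.≤ m → N ℕ.≤ n → ∣ s m ℚ.- s n ∣ ℚ.< ε)

record ℝ : Set where
  constructor mkℝ
  field
    seq      : ℕ → ℚ
    isCauchy : IsCauchy seq

open ℝ public

infix 4 _≈_

_≈_ : ℝ → ℝ → Set
x ≈ y = ∀ ε → 0ℚ ℚ.< ε →
  ∃[ N ] (∀ n → N ℕ.≤ n → ∣ seq x n ℚ.- seq y n ∣ ℚ.< ε)

private
  0<½* : ∀ {ε} → 0ℚ ℚ.< ε → 0ℚ ℚ.< ½ ℚ.* ε
  0<½* {ε} 0<ε = subst (ℚ._< ½ ℚ.* ε) (ℚₚ.*-zeroʳ ½) (ℚₚ.*-monoʳ-<-pos ½ 0<ε)

  ½+½ : ∀ ε → ½ ℚ.* ε ℚ.+ ½ ℚ.* ε ≡ ε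
  ½+½ ε = ≡.trans (≡.sym (ℚₚ.*-distribʳ-+ ε ½ ½)) (ℚₚ.*-identityˡ ε)

  ∣+∣<ε : ∀ {ε} p q → ∣ p ∣ ℚ.< ½ ℚ.* ε → ∣ q ∣ ℚ.< ½ ℚ.* ε → ∣ p ℚ.+ q ∣ ℚ.< ε
  ∣+∣<ε {ε} p q p<ε q<ε = subst (∣ p ℚ.+ q ∣ ℚ.<_) (½+½ ε)
    (ℚₚ.≤-<-trans (ℚₚ.∣p+q∣≤∣p∣+∣q∣ p q) (ℚₚ.+-mono-< p<ε q<ε))

  ∣-∣-sym : ∀ p q → ∣ p ℚ.- q ∣ ≡ ∣ q ℚ.- p ∣
  ∣-∣-sym p q = ≡.trans (cong ∣_∣ eq) (ℚₚ.∣-p∣≡∣p∣ (q ℚ.- p))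
    where
    open +-*-Solver
    eq : p ℚ.- q ≡ ℚ.- (q ℚ.- p)
    eq = solve 2 (λ p q → p :- q := :- (q :- p)) refl p q

  telescope : ∀ p q r → (p ℚ.- q) ℚ.+ (q ℚ.- r) ≡ p ℚ.- r
  telescope = solve 3 (λ p q r → (p :- q) :+ (q :- r) := p :- r) refl
    where open +-*-Solver

  interchange : ∀ p q r s → (p ℚ.- r) ℚ.+ (q ℚ.- s) ≡ (p ℚ.+ q) ℚ.- (r ℚ.+ s)
  interchange = solve 4 (λ p q r s →
    (p :- r) :+ (q :- s) := (p :+ q) :- (r :+ s)) refl
    where open +-*-Solver

≈-refl : ∀ {x} → x ≈ x
≈-refl {x} ε 0<ε = 0 , λ n _ →
  subst (ℚ._< ε) (≡.sym (cong ∣_∣ (ℚₚ.+-inverseʳ (seq x n)))) 0<ε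

≈-sym : ∀ {x y} → x ≈ y → y ≈ x
≈-sym {x} {y} x≈y ε 0<ε = let N , h = x≈y ε 0<ε in
  N , λ n N≤n → subst (ℚ._< ε) (∣-∣-sym (seq x n) (seq y n)) (h n N≤n)

≈-trans : ∀ {x y z} → x ≈ y → y ≈ z → x ≈ z
≈-trans {x} {y} {z} x≈y y≈z ε 0<ε =
  let M , h = x≈y (½ ℚ.* ε) (0<½* 0<ε)
      N , k = y≈z (½ ℚ.* ε) (0<½* 0<ε)
  in M ℕ.⊔ N , λ n M⊔N≤n →
    subst (λ p → ∣ p ∣ ℚ.< ε) (telescope (seq x n) (seq y n) (seq z n))
      (∣+∣<ε (seq x n ℚ.- seq y n) (seq y n ℚ.- seq z n)
        (h n (ℕₚ.m⊔n≤o⇒m≤o M N M⊔N≤n)) (k n (ℕₚ.m⊔n≤o⇒n≤o M N M⊔N≤n)))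

ℝ-setoid : Setoid 0ℓ 0ℓ
ℝ-setoid = record
  { Carrier       = ℝ
  ; _≈_           = _≈_
  ; isEquivalence = record
    { refl  = λ {x} → ≈-refl {x}
    ; sym   = λ {x} {y} → ≈-sym {x} {y}
    ; trans = λ {x} {y} {z} → ≈-trans {x} {y} {z}
    }
  }

infixl 6 _+_

_+_ : ℝ → ℝ → ℝ
seq      (x + y) n    = seq x n ℚ.+ seq y n
isCauchy (x + y) ε 0<ε =
  let M , h = isCauchy x (½ ℚ.* ε) (0<½* 0<ε)
      N , k = isCauchy y (½ ℚ.* ε) (0<½* 0<ε)
  in M ℕ.⊔ N , λ m n m≥ n≥ →
    subst (λ p → ∣ p ∣ ℚ.< ε) (interchange (seq x m) (seq y m) (seq x n) (seq y n))
      (∣+∣<ε (seq x m ℚ.- seq x n) (seq y m ℚ.- seq y n)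
        (h m n (ℕₚ.m⊔n≤o⇒m≤o M N m≥) (ℕₚ.m⊔n≤o⇒m≤o M N n≥))
        (k m n (ℕₚ.m⊔n≤o⇒n≤o M N m≥) (ℕₚ.m⊔n≤o⇒n≤o M N n≥)))

------------------------------------------------------------------------
-- Subsets of a setoid: predicates that respect its equality.

record Subset {a ℓ} (S : Setoid a ℓ) (p : Level) : Set (a ⊔ ℓ ⊔ suc p) where
  constructor mkSubset
  open Setoid S using (Carrier) renaming (_≈_ to _≈ₛ_)
  field
    ⟦_⟧  : Pred Carrier p
    resp : ⟦_⟧ Respects _≈ₛ_

open Subset public

module _ {a ℓ} {S : Setoid a ℓ} where

  infixr 7 _∩_

  _∩_ : ∀ {p q} → Subset S p → Subset S q → Subset S (p ⊔ q)
  ⟦ A ∩ B ⟧ = ⟦ A ⟧ U.∩ ⟦ B ⟧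
  resp (A ∩ B) x≈y (x∈A , x∈B) = resp A x≈y x∈A , resp B x≈y x∈B

  subsetSetoid : ∀ {p} → Subset S p → Setoid (a ⊔ p) ℓ
  subsetSetoid A = On.setoid {B = ∃ ⟦ A ⟧} S proj₁

  -- ∣ A ∣≡ κ : A has cardinality κ, where a cardinal is given by a type
  -- of that cardinality (taken with propositional equality).
  ∣_∣≡_ : ∀ {p} → Subset S p → Set → Set (a ⊔ ℓ ⊔ p)
  ∣ A ∣≡ κ = Bijection (≡.setoid κ) (subsetSetoid A)

-- The subsets of S, equal when they have the same elements.
powerSetoid : ∀ {a ℓ} → Setoid a ℓ → (p : Level) → Setoid (a ⊔ ℓ ⊔ suc p) (a ⊔ p)
powerSetoid S p = record
  { Carrier       = Subset S p
  ; _≈_           = λ A B → ⟦ A ⟧ ≐ ⟦ B ⟧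
  ; isEquivalence = record
    { refl  = (λ z → z) , (λ z → z)
    ; sym   = swap
    ; trans = λ (f , f⁻¹) (g , g⁻¹) → (λ z → g (f z)) , (λ z → f⁻¹ (g⁻¹ z))
    }
  }

------------------------------------------------------------------------
-- Sets of reals and families of such sets.

ℝ-Subset : Set₁
ℝ-Subset = Subset ℝ-setoid 0ℓ

Family : Set₁
Family = Subset (powerSetoid ℝ-setoid 0ℓ) 0ℓ

⋃ : Family → Subset ℝ-setoid (suc 0ℓ)
⟦ ⋃ 𝒜 ⟧ x = Σ[ A ∈ ℝ-Subset ] A ∈ ⟦ 𝒜 ⟧ × x ∈ ⟦ A ⟧
resp (⋃ 𝒜) x≈y (A , A∈𝒜 , x∈A) = A , A∈𝒜 , resp A x≈y x∈A

｛_,_｝ : ℝ-Subset → ℝ-Subset → Family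
⟦ ｛ A , B ｝ ⟧ X = (⟦ X ⟧ ≐ ⟦ A ⟧) ⊎ (⟦ X ⟧ ≐ ⟦ B ⟧)
resp ｛ A , B ｝ {X} {Y} X≐Y = Sum.map
  (λ X≐A → trans {Y} {X} {A} (sym {X} {Y} X≐Y) X≐A)
  (λ X≐B → trans {Y} {X} {B} (sym {X} {Y} X≐Y) X≐B)
  where open Setoid (powerSetoid ℝ-setoid 0ℓ)

infixl 6 _⊕_

_⊕_ : ℝ-Subset → ℝ → ℝ-Subset
⟦ F ⊕ t ⟧ y = ∃[ x ] x ∈ ⟦ F ⟧ × y ≈ x + t
resp (F ⊕ t) {y} {z} y≈z (x , x∈F , y≈x+t) =
  x , x∈F , ≈-trans {z} {y} {x + t} (≈-sym {y} {z} y≈z) y≈x+t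

PairwiseDisjoint : Family → Set₁
PairwiseDisjoint 𝒜 = ∀ A B → A ∈ ⟦ 𝒜 ⟧ → B ∈ ⟦ 𝒜 ⟧ →
  ¬ (⟦ A ⟧ ≐ ⟦ B ⟧) → ⟦ A ⟧ ⊥ ⟦ B ⟧

record IsPartition (𝒜 : Family) : Set₁ where
  field
    nonempty : ∀ A → A ∈ ⟦ 𝒜 ⟧ → U.Satisfiable ⟦ A ⟧
    disjoint : PairwiseDisjoint 𝒜
    covers   : U.Universal ⟦ ⋃ 𝒜 ⟧

------------------------------------------------------------------------
-- Coverings

record IsSCovering (κ : Set) (𝒜 : Family) : Set₁ where
  field
    disjoint    : PairwiseDisjoint 𝒜
    cardinality : ∣ 𝒜 ∣≡ κ
    translate   : ∀ (F : ℝ-Subset) → ∣ F ∣≡ κ →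
      ∃[ t ] ⟦ F ⊕ t ⟧ ⊆ ⟦ ⋃ 𝒜 ⟧ ×
             (∀ A → A ∈ ⟦ 𝒜 ⟧ → ∣ (F ⊕ t) ∩ A ∣≡ Fin 1)

IsCovering : Set → ℝ-Subset → Set₁
IsCovering κ A = ∀ (B : ℝ-Subset) → ∣ B ∣≡ κ → ∃[ x ] ⟦ B ⊕ x ⟧ ⊆ ⟦ A ⟧

{-# OPTIONS --safe #-}

-- If neither A₀ nor A₁ is a 2-covering, then some {p, q} has no translate inside
-- A₀ and some {r, s} has no translate inside A₁.  Hence z + (p + r) ∈ A₀ forces
-- z + (q + r) ∈ A₁ and then z + (q + s) ∈ A₀, and similarly with A₀ and A₁
-- exchanged: no translate of {p + r, q + s} is split by the partition, so the
-- 2-S-covering property gives p + r = q + s.  By symmetry also p + s = q + r, and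
-- adding the two equations yields p = q.  Sums of the given points, rather than
-- the differences q − p and s − r, avoid subtraction of reals.

module Submission where

open import Defs
open import Axiom.ExcludedMiddle using (ExcludedMiddle)
open import Data.Empty using (⊥-elim)
open import Data.Fin.Base using (Fin)
open import Data.Fin.Patterns using (0F; 1F)
import Data.Nat.Base as ℕ
import Data.Nat.Properties as ℕₚ
open import Data.Product.Base using (∃-syntax; _×_; _,_; proj₁)
open import Data.Rational.Base as ℚ using (ℚ; ½; ∣_∣)
import Data.Rational.Properties as ℚₚ
open import Data.Rational.Solver using (module +-*-Solver)
open import Data.Sum.Base as Sum using (_⊎_; inj₁; inj₂)
open import Function.Bundles using (Bijection)
open import Level using (0ℓ; suc; Lift; lift; lower)
open import Relation.Binary.PropositionalEquality as ≡ using (_≡_; refl)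
open import Relation.Nullary.Decidable.Core using (decidable-stable; map′; toSum)
open import Relation.Nullary.Negation.Core using (¬_)
open import Relation.Unary using (_∈_; _⊆_)

-- Addition of reals is termwise, so its laws reduce through this to rational identities holding at
-- every index.
≗⇒≈ : ∀ {x y} → (∀ n → seq x n ≡ seq y n) → x ≈ y
≗⇒≈ {x} x≗y ε 0<ε = let N , h = ≈-refl {x} ε 0<ε in
  N , λ n N≤n → ≡.subst (λ q → ∣ seq x n ℚ.- q ∣ ℚ.< ε) (x≗y n) (h n N≤n)

+-assoc : ∀ x y z → (x + y) + z ≈ x + (y + z)
+-assoc x y z = ≗⇒≈ {(x + y) + z} {x + (y + z)}
  λ n → ℚₚ.+-assoc (seq x n) (seq y n) (seq z n)

x+[y+z]≈y+[x+z] : ∀ x y z → x + (y + z) ≈ y + (x + z)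
x+[y+z]≈y+[x+z] x y z = ≗⇒≈ {x + (y + z)} {y + (x + z)}
  λ n → solve 3 (λ p q r → p :+ (q :+ r) := q :+ (p :+ r)) refl
          (seq x n) (seq y n) (seq z n)
  where open +-*-Solver

[p+r]-[q+r]≡p-q : ∀ p q r → (p ℚ.+ r) ℚ.- (q ℚ.+ r) ≡ p ℚ.- q
[p+r]-[q+r]≡p-q = solve 3 (λ p q r → (p :+ r) :- (q :+ r) := p :- q) refl
  where open +-*-Solver

+-congʳ : ∀ {x y} z → x ≈ y → x + z ≈ y + z
+-congʳ {x} {y} z x≈y ε 0<ε = let N , h = x≈y ε 0<ε in
  N , λ n N≤n → ≡.subst (λ d → ∣ d ∣ ℚ.< ε)
    (≡.sym ([p+r]-[q+r]≡p-q (seq x n) (seq y n) (seq z n))) (h n N≤n)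

+-cancelʳ : ∀ {x y} z → x + z ≈ y + z → x ≈ y
+-cancelʳ {x} {y} z x+z≈y+z ε 0<ε = let N , h = x+z≈y+z ε 0<ε in
  N , λ n N≤n → ≡.subst (λ d → ∣ d ∣ ℚ.< ε)
    ([p+r]-[q+r]≡p-q (seq x n) (seq y n) (seq z n)) (h n N≤n)

∣½[p+q]∣<ε : ∀ {ε} p q → ∣ p ∣ ℚ.< ε → ∣ q ∣ ℚ.< ε → ∣ ½ ℚ.* (p ℚ.+ q) ∣ ℚ.< ε
∣½[p+q]∣<ε {ε} p q ∣p∣<ε ∣q∣<ε = begin-strict
  ∣ ½ ℚ.* (p ℚ.+ q) ∣      ≡⟨ ℚₚ.∣p*q∣≡∣p∣*∣q∣ ½ (p ℚ.+ q) ⟩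
  ½ ℚ.* ∣ p ℚ.+ q ∣        ≤⟨ ℚₚ.*-monoˡ-≤-nonNeg ½ (ℚₚ.∣p+q∣≤∣p∣+∣q∣ p q) ⟩
  ½ ℚ.* (∣ p ∣ ℚ.+ ∣ q ∣)  <⟨ ℚₚ.*-monoʳ-<-pos ½ (ℚₚ.+-mono-< ∣p∣<ε ∣q∣<ε) ⟩
  ½ ℚ.* (ε ℚ.+ ε)          ≡⟨ solve 1 (λ e → con ½ :* (e :+ e) := e) refl ε ⟩
  ε                        ∎
  where
  open ℚₚ.≤-Reasoning
  open +-*-Solver

-- `p - q` is the average of `(p + r) - (q + s)` and `(p + s) - (q + r)`. An average of two
-- quantities below `ε` is below `ε`, so both hypotheses are used at `ε` itself.
cross-sums⇒≈ : ∀ p q r s → p + r ≈ q + s → p + s ≈ q + r → p ≈ q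
cross-sums⇒≈ p q r s p+r≈q+s p+s≈q+r ε 0<ε =
  let M , h = p+r≈q+s ε 0<ε
      N , k = p+s≈q+r ε 0<ε
  in M ℕ.⊔ N , λ n M⊔N≤n → ≡.subst (λ d → ∣ d ∣ ℚ.< ε)
    (average (seq p n) (seq q n) (seq r n) (seq s n))
    (∣½[p+q]∣<ε (seq (p + r) n ℚ.- seq (q + s) n) (seq (p + s) n ℚ.- seq (q + r) n)
      (h n (ℕₚ.m⊔n≤o⇒m≤o M N M⊔N≤n)) (k n (ℕₚ.m⊔n≤o⇒n≤o M N M⊔N≤n)))
  where
  open +-*-Solver
  average : ∀ a b c d →
    ½ ℚ.* (((a ℚ.+ c) ℚ.- (b ℚ.+ d)) ℚ.+ ((a ℚ.+ d) ℚ.- (b ℚ.+ c))) ≡ a ℚ.- b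
  average = solve 4 (λ a b c d →
    con ½ :* (((a :+ c) :- (b :+ d)) :+ ((a :+ d) :- (b :+ c))) := a :- b) refl

pair : ℝ → ℝ → ℝ-Subset
⟦ pair u v ⟧ x = x ≈ u ⊎ x ≈ v
resp (pair u v) {x} {y} x≈y (inj₁ x≈u) = inj₁ (≈-trans {y} {x} {u} (≈-sym {x} {y} x≈y) x≈u)
resp (pair u v) {x} {y} x≈y (inj₂ x≈v) = inj₂ (≈-trans {y} {x} {v} (≈-sym {x} {y} x≈y) x≈v)

∣pair∣≡2 : ∀ {u v} → ¬ u ≈ v → ∣ pair u v ∣≡ Fin 2
∣pair∣≡2 {u} {v} u≉v = record
  { to        = to
  ; cong      = λ { {i} refl → ≈-refl {proj₁ (to i)} }
  ; bijective = (λ {i} {j} → injective i j) , surjective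
  }
  where
  to : Fin 2 → ∃[ x ] x ∈ ⟦ pair u v ⟧
  to 0F = u , inj₁ (≈-refl {u})
  to 1F = v , inj₂ (≈-refl {v})

  injective : ∀ i j → proj₁ (to i) ≈ proj₁ (to j) → i ≡ j
  injective 0F 0F _   = refl
  injective 0F 1F u≈v = ⊥-elim (u≉v u≈v)
  injective 1F 0F v≈u = ⊥-elim (u≉v (≈-sym {v} {u} v≈u))
  injective 1F 1F _   = refl

  surjective : ∀ y → ∃[ i ] (∀ {j} → j ≡ i → proj₁ (to j) ≈ proj₁ y)
  surjective (y , inj₁ y≈u) = 0F , λ { refl → ≈-sym {y} {u} y≈u }
  surjective (y , inj₂ y≈v) = 1F , λ { refl → ≈-sym {y} {v} y≈v }

∣A∣≡1⇒≈ : ∀ {p} (A : Subset ℝ-setoid p) → ∣ A ∣≡ Fin 1 →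
  ∀ {x y} → x ∈ ⟦ A ⟧ → y ∈ ⟦ A ⟧ → x ≈ y
∣A∣≡1⇒≈ A bij {x} {y} x∈A y∈A
  with Bijection.strictlySurjective bij (x , x∈A) | Bijection.strictlySurjective bij (y , y∈A)
... | 0F , z≈x | 0F , z≈y =
  ≈-trans {x} {z} {y} (≈-sym {z} {x} z≈x) z≈y
  where z = proj₁ (Bijection.to bij 0F)

module _ (B : ℝ-Subset) (∣B∣≡2 : ∣ B ∣≡ Fin 2) where

  open Bijection ∣B∣≡2 using (to; injective; strictlySurjective)

  point : Fin 2 → ℝ
  point i = proj₁ (to i)

  points-distinct : ¬ point 0F ≈ point 1F
  points-distinct p≈q with () ← injective p≈q

  points-translate : ∀ (A : ℝ-Subset) {x} →
    (∀ i → point i + x ∈ ⟦ A ⟧) → ⟦ B ⊕ x ⟧ ⊆ ⟦ A ⟧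
  points-translate A {x} h {y} (b , b∈B , y≈b+x) =
    let i , p≈b = strictlySurjective (b , b∈B)
    in resp A {point i + x} {y}
         (≈-trans {point i + x} {b + x} {y} (+-congʳ {point i} {b} x p≈b)
           (≈-sym {y} {b + x} y≈b+x))
         (h i)

-- Says that no translate of the set with elements `p` and `q` lies inside `A`. Stated on points, it
-- can be chained with a cover: stepping from `p + x` to `q + x` leaves `A`.
Avoids : ℝ-Subset → ℝ → ℝ → Set
Avoids A p q = ∀ x → p + x ∈ ⟦ A ⟧ → ¬ q + x ∈ ⟦ A ⟧

Avoids-sym : ∀ {A p q} → Avoids A p q → Avoids A q p
Avoids-sym avoids x q+x∈A p+x∈A = avoids x p+x∈A q+x∈A

no-translate⇒Avoids : ∀ A B (∣B∣≡2 : ∣ B ∣≡ Fin 2) →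
  ¬ (∃[ x ] ⟦ B ⊕ x ⟧ ⊆ ⟦ A ⟧) →
  Avoids A (point B ∣B∣≡2 0F) (point B ∣B∣≡2 1F)
no-translate⇒Avoids A B ∣B∣≡2 none x p+x∈A q+x∈A =
  none (x , points-translate B ∣B∣≡2 A {x} λ { 0F → p+x∈A ; 1F → q+x∈A })

covers⇒∈⊎∈ : ∀ {A₀ A₁} → IsPartition ｛ A₀ , A₁ ｝ → ∀ x → x ∈ ⟦ A₀ ⟧ ⊎ x ∈ ⟦ A₁ ⟧
covers⇒∈⊎∈ part x with IsPartition.covers part x
... | _ , inj₁ (X⊆A₀ , _) , x∈X = inj₁ (X⊆A₀ x∈X)
... | _ , inj₂ (X⊆A₁ , _) , x∈X = inj₂ (X⊆A₁ x∈X)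

-- Were `u` and `v` distinct, `pair u v` would have two elements, and some translate of it would
-- meet each member of `𝒜` exactly once. The member containing both `u + t` and `v + t` then forces
-- them to coincide. The double negation remains because the covering property applies only once `u`
-- and `v` are known to differ.
unsplit⇒¬¬≈ : ∀ {𝒜} → IsSCovering (Fin 2) 𝒜 → ∀ {u v} →
  (∀ t → ∃[ A ] A ∈ ⟦ 𝒜 ⟧ × u + t ∈ ⟦ A ⟧ × v + t ∈ ⟦ A ⟧) → ¬ ¬ u ≈ v
unsplit⇒¬¬≈ cov {u} {v} unsplit u≉v =
  let t , _ , one = IsSCovering.translate cov (pair u v) (∣pair∣≡2 {u} {v} u≉v)
      A , A∈𝒜 , u+t∈A , v+t∈A = unsplit t
  in u≉v (+-cancelʳ {u} {v} t (∣A∣≡1⇒≈ ((pair u v ⊕ t) ∩ A) (one A A∈𝒜)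
       ((u , inj₁ (≈-refl {u}) , ≈-refl {u + t}) , u+t∈A)
       ((v , inj₂ (≈-refl {v}) , ≈-refl {v + t}) , v+t∈A)))

Avoids-step : ∀ {A A′ : ℝ-Subset} → (∀ x → x ∈ ⟦ A ⟧ ⊎ x ∈ ⟦ A′ ⟧) →
  ∀ {p q} → Avoids A p q → ∀ x → p + x ∈ ⟦ A ⟧ → q + x ∈ ⟦ A′ ⟧
Avoids-step cover {p} {q} avoids x p+x∈A with cover (q + x)
... | inj₁ q+x∈A  = ⊥-elim (avoids x p+x∈A q+x∈A)
... | inj₂ q+x∈A′ = q+x∈A′

-- Replacing `p` by `q` moves from `A` to `A′`, and replacing `r` by `s` moves back. Commuting the
-- summands brings the one to be replaced to the front.
Avoids-step² : ∀ {A A′ : ℝ-Subset} → (∀ x → x ∈ ⟦ A ⟧ ⊎ x ∈ ⟦ A′ ⟧) →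
  ∀ {p q r s} → Avoids A p q → Avoids A′ r s →
  ∀ t → p + (r + t) ∈ ⟦ A ⟧ → q + (s + t) ∈ ⟦ A ⟧
Avoids-step² {A} {A′} cover {p} {q} {r} {s} avoids avoids′ t p+[r+t]∈A =
  resp A {s + (q + t)} {q + (s + t)} (x+[y+z]≈y+[x+z] s q t)
    (Avoids-step {A′} {A} (λ x → Sum.swap (cover x)) {r} {s} avoids′ (q + t)
      (resp A′ {q + (r + t)} {r + (q + t)} (x+[y+z]≈y+[x+z] q r t)
        (Avoids-step {A} {A′} cover {p} {q} avoids (r + t) p+[r+t]∈A)))

module _ (A₀ A₁ : ℝ-Subset)
  (part : IsPartition ｛ A₀ , A₁ ｝) (cov : IsSCovering (Fin 2) ｛ A₀ , A₁ ｝) where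

  Avoids⇒¬¬≈ : ∀ {p q r s} → Avoids A₀ p q → Avoids A₁ r s → ¬ ¬ p + r ≈ q + s
  Avoids⇒¬¬≈ {p} {q} {r} {s} avoids₀ avoids₁ =
    unsplit⇒¬¬≈ cov {p + r} {q + s} unsplit
    where
    cover : ∀ x → x ∈ ⟦ A₀ ⟧ ⊎ x ∈ ⟦ A₁ ⟧
    cover = covers⇒∈⊎∈ {A₀} {A₁} part

    x+[y+z]≈[x+y]+z : ∀ x y z → x + (y + z) ≈ (x + y) + z
    x+[y+z]≈[x+y]+z x y z = ≈-sym {(x + y) + z} {x + (y + z)} (+-assoc x y z)

    unsplit : ∀ t → ∃[ A ] A ∈ ⟦ ｛ A₀ , A₁ ｝ ⟧ ×
      (p + r) + t ∈ ⟦ A ⟧ × (q + s) + t ∈ ⟦ A ⟧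
    unsplit t with cover (p + (r + t))
    ... | inj₁ ∈A₀ = A₀ , inj₁ ((λ z → z) , (λ z → z)) ,
      resp A₀ {p + (r + t)} {(p + r) + t} (x+[y+z]≈[x+y]+z p r t) ∈A₀ ,
      resp A₀ {q + (s + t)} {(q + s) + t} (x+[y+z]≈[x+y]+z q s t)
        (Avoids-step² {A₀} {A₁} cover {p} {q} {r} {s} avoids₀ avoids₁ t ∈A₀)
    -- Starting in `A₁`, the replacements are made in the other order: `r` by `s` leads to `A₀`,
    -- then `p` by `q` returns to `A₁`.
    ... | inj₂ ∈A₁ = A₁ , inj₂ ((λ z → z) , (λ z → z)) ,
      resp A₁ {p + (r + t)} {(p + r) + t} (x+[y+z]≈[x+y]+z p r t) ∈A₁ ,
      resp A₁ {q + (s + t)} {(q + s) + t} (x+[y+z]≈[x+y]+z q s t)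
        (resp A₁ {s + (q + t)} {q + (s + t)} (x+[y+z]≈y+[x+z] s q t)
          (Avoids-step² {A₁} {A₀} (λ x → Sum.swap (cover x)) {r} {s} {p} {q}
            avoids₁ avoids₀ t
            (resp A₁ {p + (r + t)} {r + (p + t)} (x+[y+z]≈y+[x+z] p r t) ∈A₁)))

  Avoids⇒¬¬points≈ : ∀ {p q r s} → Avoids A₀ p q → Avoids A₁ r s → ¬ ¬ p ≈ q
  Avoids⇒¬¬points≈ {p} {q} {r} {s} avoids₀ avoids₁ p≉q =
    -- The goal is now absurdity, so both doubly negated equations may be unwrapped without excluded
    -- middle. The second comes from exchanging `r` and `s`.
    Avoids⇒¬¬≈ {p} {q} {r} {s} avoids₀ avoids₁ λ p+r≈q+s →
    Avoids⇒¬¬≈ {p} {q} {s} {r} avoids₀ (Avoids-sym {A₁} {r} {s} avoids₁) λ p+s≈q+r →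
    p≉q (cross-sums⇒≈ p q r s p+r≈q+s p+s≈q+r)

mainTheorem9 : ExcludedMiddle (suc 0ℓ) →
    (A₀ A₁ : ℝ-Subset) →
    IsPartition ｛ A₀ , A₁ ｝ →
    IsSCovering (Fin 2) ｛ A₀ , A₁ ｝ →
    IsCovering (Fin 2) A₀ ⊎ IsCovering (Fin 2) A₁
mainTheorem9 em A₀ A₁ part cov =
  -- Excluded middle decides whether `A₀` is a 2-covering. If not, a set `C` without a translate
  -- inside `A₁` is refuted by showing that `A₀` would be one after all.
  Sum.map₂ (λ ¬covering₀ C ∣C∣≡2 → by-contradiction λ none₁ →
    ¬covering₀ λ B ∣B∣≡2 → by-contradiction λ none₀ →
    Avoids⇒¬¬points≈ A₀ A₁ part cov
      {point B ∣B∣≡2 0F} {point B ∣B∣≡2 1F} {point C ∣C∣≡2 0F} {point C ∣C∣≡2 1F}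
      (no-translate⇒Avoids A₀ B ∣B∣≡2 none₀) (no-translate⇒Avoids A₁ C ∣C∣≡2 none₁)
      (points-distinct B ∣B∣≡2))
    (toSum (em {IsCovering (Fin 2) A₀}))
  where
  by-contradiction : ∀ {P : Set} → ¬ ¬ P → P
  -- `em` lives one level up because `IsCovering` quantifies over subsets, so a small proposition is
  -- lifted before it is decided.
  by-contradiction {P} = decidable-stable (map′ lower lift (em {Lift (suc 0ℓ) P}))
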